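{- (1) There is a finite undirected graph that is $\mathbb{Z}_2^2$-connected but not $\mathbb{Z}_4$-connected. (2) There is a finite undirected graph that is $\mathbb{Z}_4$-connected but not $\mathbb{Z}_2^2$-connected.
   Context: Here $\mathbb{Z}_4$ is the cyclic group of order 4 and $\mathbb{Z}_2^2=\mathbb{Z}_2\times\mathbb{Z}_2$. Let $\Gamma$ be an abelian group, written additively. A $\Gamma$-flow in a digraph $G=(V,E)$ is a map $\varphi\colon E\to\Gamma$ such that for every vertex $v\in V$, $\sum_{e \text{ ends at } v}\varphi(e)=\sum_{e\text{ starts at }v}\varphi(e)$. A digraph $G=(V,E)$ is $\Gamma$-connected if for every mapping $h\colon E\to\Gamma$ there is a $\Gamma$-flow $\varphi$ on $G$ with $\varphi(e)\neq h(e)$ for every edge $e\in E$. This property does not change when the orientation of an edge is reversed; an undirected graph is called $\Gamma$-connected if some (equivalently, every) orientation of it is $\Gamma$-connected. -}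

module Defs where

open import Algebra.Bundles using (AbelianGroup)
import Algebra.Construct.DirectProduct as DirectProduct
import Algebra.Properties.CommutativeMonoid.Sum as Sum
open import Data.Bool.Base using (if_then_else_)
open import Data.Fin.Base using (Fin; toℕ)
open import Data.Fin.Properties using (_≟_; toℕ-fromℕ<; toℕ<n; toℕ≤n; toℕ-injective)
open import Data.Fin.Subset using (Subset; ⁅_⁆; _∪_; ∣_∣)
open import Data.Nat.Base using (ℕ; NonZero; >-nonZero⁻¹; _+_; _∸_; _%_)
open import Data.Nat.DivMod
  using (_mod_; m%n<n; %-distribˡ-+; m%n%n≡m%n; m<n⇒m%n≡m; n%n≡0)
open import Data.Nat.Properties using (+-comm; +-assoc; m∸n+n≡m)
open import Data.Product.Base using (_×_; _,_; ∃; Σ-syntax)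
open import Function.Definitions using (Injective)
open import Level using (Level; 0ℓ; _⊔_)
open import Relation.Binary.PropositionalEquality
open import Relation.Nullary.Decidable using (⌊_⌋)
open import Relation.Nullary.Negation using (¬_)

private
  variable
    c ℓ : Level
    n m : ℕ

-- ℤ/nℤ with the residues 0, …, n-1 as carrier.
module _ (k : ℕ) .{{_ : NonZero k}} where

  private
    _⊕_ : Fin k → Fin k → Fin k
    i ⊕ j = (toℕ i + toℕ j) mod k

    0# : Fin k
    0# = 0 mod k

    ⊖_ : Fin k → Fin k
    ⊖ i = (k ∸ toℕ i) mod k

    toℕ-mod : ∀ a → toℕ (a mod k) ≡ a % k
    toℕ-mod a = toℕ-fromℕ< (m%n<n a k)

    mod-cong : ∀ {a b} → a % k ≡ b % k → a mod k ≡ b mod k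
    mod-cong {a} {b} eq =
      toℕ-injective (trans (toℕ-mod a) (trans eq (sym (toℕ-mod b))))

    mod-toℕ : ∀ i → toℕ i mod k ≡ i
    mod-toℕ i = toℕ-injective (trans (toℕ-mod (toℕ i)) (m<n⇒m%n≡m (toℕ<n i)))

    %-absorbˡ : ∀ a b → (a % k + b) % k ≡ (a + b) % k
    %-absorbˡ a b = begin
      (a % k + b) % k          ≡⟨ %-distribˡ-+ (a % k) b k ⟩
      (a % k % k + b % k) % k  ≡⟨ cong (λ x → (x + b % k) % k) (m%n%n≡m%n a k) ⟩
      (a % k + b % k) % k      ≡⟨ %-distribˡ-+ a b k ⟨
      (a + b) % k              ∎
      where open ≡-Reasoning

    mod-absorbˡ : ∀ a i → (a mod k) ⊕ i ≡ (a + toℕ i) mod k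
    mod-absorbˡ a i = trans
      (cong (λ x → (x + toℕ i) mod k) (toℕ-mod a))
      (mod-cong (%-absorbˡ a (toℕ i)))

    ⊕-comm : ∀ i j → i ⊕ j ≡ j ⊕ i
    ⊕-comm i j = cong (_mod k) (+-comm (toℕ i) (toℕ j))

    ⊕-assoc : ∀ h i j → (h ⊕ i) ⊕ j ≡ h ⊕ (i ⊕ j)
    ⊕-assoc h i j = begin
      (h ⊕ i) ⊕ j                      ≡⟨ mod-absorbˡ (toℕ h + toℕ i) j ⟩
      (toℕ h + toℕ i + toℕ j) mod k    ≡⟨ cong (_mod k) (+-assoc (toℕ h) (toℕ i) (toℕ j)) ⟩
      (toℕ h + (toℕ i + toℕ j)) mod k  ≡⟨ cong (_mod k) (+-comm (toℕ h) (toℕ i + toℕ j)) ⟩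
      (toℕ i + toℕ j + toℕ h) mod k    ≡⟨ mod-absorbˡ (toℕ i + toℕ j) h ⟨
      (i ⊕ j) ⊕ h                      ≡⟨ ⊕-comm (i ⊕ j) h ⟩
      h ⊕ (i ⊕ j)                      ∎
      where open ≡-Reasoning

    ⊕-identityˡ : ∀ i → 0# ⊕ i ≡ i
    ⊕-identityˡ i = trans (mod-absorbˡ 0 i) (mod-toℕ i)

    ⊕-inverseˡ : ∀ i → (⊖ i) ⊕ i ≡ 0#
    ⊕-inverseˡ i = begin
      (⊖ i) ⊕ i                  ≡⟨ mod-absorbˡ (k ∸ toℕ i) i ⟩
      (k ∸ toℕ i + toℕ i) mod k  ≡⟨ cong (_mod k) (m∸n+n≡m (toℕ≤n i)) ⟩
      k mod k                    ≡⟨ mod-cong (trans (n%n≡0 k) (sym (m<n⇒m%n≡m 0<k))) ⟩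
      0#                         ∎
      where
      open ≡-Reasoning
      0<k = >-nonZero⁻¹ k

  ℤ/ : AbelianGroup 0ℓ 0ℓ
  ℤ/ = record
    { Carrier = Fin k
    ; _≈_     = _≡_
    ; _∙_     = _⊕_
    ; ε       = 0#
    ; _⁻¹     = ⊖_
    ; isAbelianGroup = record
      { isGroup = record
        { isMonoid = record
          { isSemigroup = record
            { isMagma = record { isEquivalence = isEquivalence ; ∙-cong = cong₂ _⊕_ }
            ; assoc   = ⊕-assoc
            }
          ; identity = ⊕-identityˡ , λ i → trans (⊕-comm i 0#) (⊕-identityˡ i)
          }
        ; inverse = ⊕-inverseˡ , λ i → trans (⊕-comm i (⊖ i)) (⊕-inverseˡ i)
        ; ⁻¹-cong = cong ⊖_
        }
      ; comm = ⊕-comm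
      }
    }

ℤ₄ : AbelianGroup 0ℓ 0ℓ
ℤ₄ = ℤ/ 4

ℤ₂² : AbelianGroup 0ℓ 0ℓ
ℤ₂² = DirectProduct.abelianGroup (ℤ/ 2) (ℤ/ 2)

-- Digraphs with n vertices and m edges; loops and parallel edges are allowed.
record Digraph (n m : ℕ) : Set where
  field
    source : Fin m → Fin n
    target : Fin m → Fin n

-- Simple undirected graphs with n vertices and m edges: the edges enumerate,
-- without repetition, a collection of two-element sets of vertices.
record Graph (n m : ℕ) : Set where
  field
    ends           : Fin m → Subset n
    ∣ends∣≡2       : ∀ e → ∣ ends e ∣ ≡ 2
    ends-injective : Injective _≡_ _≡_ ends

_IsOrientationOf_ : Digraph n m → Graph n m → Set
D IsOrientationOf G = ∀ e → ⁅ source e ⁆ ∪ ⁅ target e ⁆ ≡ ends e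
  where
  open Digraph D
  open Graph G

module _ (Γ : AbelianGroup c ℓ) where

  open AbelianGroup Γ using (Carrier; _≈_; ε; commutativeMonoid)
  open Sum commutativeMonoid using (sum)

  IsFlow : Digraph n m → (Fin m → Carrier) → Set ℓ
  IsFlow D φ = ∀ v →
    sum (λ e → if ⌊ target e ≟ v ⌋ then φ e else ε) ≈
    sum (λ e → if ⌊ source e ≟ v ⌋ then φ e else ε)
    where open Digraph D

  DigraphConnected : Digraph n m → Set (c ⊔ ℓ)
  DigraphConnected {m = m} D =
    (h : Fin m → Carrier) →
    Σ[ φ ∈ (Fin m → Carrier) ] IsFlow D φ × (∀ e → ¬ (φ e ≈ h e))

  Connected : Graph n m → Set (c ⊔ ℓ)
  Connected G = ∃ λ D → D IsOrientationOf G × DigraphConnected D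

{-# OPTIONS --safe #-}

-- Both graphs have a Hamiltonian path.  Orient it forwards and the remaining edges
-- (chords) backwards: a flow is then an arbitrary assignment y of group elements to
-- the chords, and each path edge carries the sum of y over the chords spanning it.
--
-- Γ-connectivity is proved in two stages, seeing Γ (of order 4) as an extension of
-- ℤ/2 by ℤ/2.  First choose the images of y in the quotient.  An edge whose image
-- differs from that of its forbidden value is safe; each other edge imposes one
-- 𝔽₂-linear equation on the remaining bits of y.  If the rows of these equations are
-- independent, the equations are solvable whatever the remaining bits of the forbidden
-- values are, so only the images of the forbidden values have to be enumerated, and
-- these may be taken trivial on the chords.  For the first graph just two patterns
-- admit no good choice.  Now ℤ₂² has three quotients of order 2, whose projections sum
-- to zero, and no two bad patterns sum to a bad one: some quotient sees a good pattern.
-- For the second graph and ℤ₄ the few bad patterns are settled by enumerating the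
-- remaining bits too.
--
-- Non-connectivity is a depth-first search showing that no flow avoids one explicit
-- assignment of forbidden values.
module Submission where

open import Defs
open import Algebra.Bundles using (AbelianGroup)
import Algebra.Definitions.RawMonoid as RawMonoid
import Algebra.Properties.AbelianGroup as AbelianGroupProperties
import Algebra.Properties.CommutativeMonoid.Sum as Sum
import Algebra.Properties.CommutativeSemigroup as CommutativeSemigroupProperties
open import Data.Bool.Base using (Bool; true; false; not; _∧_; _∨_; _xor_; if_then_else_)
open import Data.Bool.ListAction using (all)
open import Data.Bool.Properties
  using (∧-conicalˡ; ∧-conicalʳ; xor-same; xor-assoc; xor-comm; xor-identityʳ; not-distribˡ-xor)
  renaming (_≟_ to _≟ᵇ_)
open import Data.Fin using (#_)
open import Data.Fin.Base using (Fin; zero; suc; toℕ; inject₁)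
open import Data.Fin.Patterns using (0F; 1F; 2F; 3F)
open import Data.Fin.Properties using (_≟_; all?)
open import Data.Fin.Subset using (Subset; ⁅_⁆; _∪_; ∣_∣; _∈_)
open import Data.Fin.Subset.Properties using (x∈⁅x⁆; x∈⁅y⁆⇒x≡y; x∈p∪q⁺; x∈p∪q⁻)
open import Data.List.Base as List using (List; []; _∷_; _++_; length)
open import Data.List.Relation.Unary.All as All using (All; []; _∷_)
import Data.List.Relation.Unary.All.Properties as All
open import Data.List.Relation.Unary.Any using (Any; here; there; any?)
open import Data.Nat.Base using (ℕ; zero; suc; _+_; _≤ᵇ_; _<ᵇ_)
import Data.Nat.Properties as ℕ
open import Data.Product.Base using (_×_; _,_; proj₁; proj₂; ∃; Σ-syntax; ∃₂)
open import Data.Product.Relation.Binary.Pointwise.NonDependent using (×-decidable)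
open import Data.Sum.Base using (_⊎_; inj₁; inj₂)
open import Data.Vec.Base as Vec using (Vec; []; _∷_; zipWith; lookup; tabulate)
open import Data.Vec.Properties
  using (≡-dec; map-++; map-replicate; lookup∘tabulate; tabulate∘lookup;
         lookup∘updateAt; lookup∘updateAt′; lookup-replicate)
open import Data.Vec.Relation.Binary.Pointwise.Inductive as Pointwise using (Pointwise; []; _∷_)
open import Function.Base using (_∘_)
open import Level using (Level; _⊔_)
open import Relation.Binary.Definitions using (Decidable; DecidableEquality)
open import Relation.Binary.PropositionalEquality
  using (_≡_; _≢_; refl; sym; trans; cong; cong₂; subst)
open import Relation.Nullary.Decidable using (Dec; ⌊_⌋; yes; no; True; toWitness; ¬?; _→-dec_)
open import Relation.Nullary.Negation using (¬_; contradiction)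

private
  variable
    c ℓ : Level
    n m t β : ℕ

-- Linear systems over 𝔽₂

dot : Vec Bool n → Vec Bool n → Bool
dot []          []       = false
dot (true ∷ r)  (b ∷ x) = b xor dot r x
dot (false ∷ r) (_ ∷ x) = dot r x

_⊕_ : Vec Bool n → Vec Bool n → Vec Bool n
_⊕_ = zipWith _xor_

dot-⊕ : (r s x : Vec Bool n) → dot (r ⊕ s) x ≡ dot r x xor dot s x
dot-⊕ []          []          []          = refl
dot-⊕ (false ∷ r) (false ∷ s) (_ ∷ x)     = dot-⊕ r s x
dot-⊕ (true ∷ r)  (false ∷ s) (b ∷ x)     =
  trans (cong (b xor_) (dot-⊕ r s x)) (sym (xor-assoc b (dot r x) (dot s x)))
dot-⊕ (false ∷ r) (true ∷ s)  (false ∷ x) = dot-⊕ r s x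
dot-⊕ (false ∷ r) (true ∷ s)  (true ∷ x)  = trans (cong not (dot-⊕ r s x))
  (trans (not-distribˡ-xor (dot r x) (dot s x)) (not-xor (dot r x) (dot s x)))
  where
  not-xor : ∀ a b → not a xor b ≡ a xor not b
  not-xor false b = refl
  not-xor true  false = refl
  not-xor true  true = refl
dot-⊕ (true ∷ r)  (true ∷ s)  (false ∷ x) = dot-⊕ r s x
dot-⊕ (true ∷ r)  (true ∷ s)  (true ∷ x)  =
  trans (dot-⊕ r s x) (xor-not (dot r x) (dot s x))
  where
  xor-not : ∀ a b → a xor b ≡ not a xor not b
  xor-not false false = refl
  xor-not false true  = refl
  xor-not true  b     = refl

Equation : ℕ → Set
Equation n = Vec Bool n × Bool

Solves : Vec Bool n → List (Equation n) → Set
Solves x = All (λ (r , t) → dot r x ≡ t)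

cancel : Equation n → Equation (suc n) → Equation n
cancel (p , t) (true ∷ r  , u) = p ⊕ r , t xor u
cancel (p , t) (false ∷ r , u) = r , u

-- Gaussian elimination of the first unknown. The first equation containing it is the pivot: it is
-- dropped after being added to the later equations that contain the unknown. Without a pivot the
-- unknown is free.
eliminate : List (Equation (suc n)) → List (Equation n)
eliminate []                     = []
eliminate ((false ∷ r , t) ∷ es) = (r , t) ∷ eliminate es
eliminate ((true ∷ r , t) ∷ es)  = List.map (cancel (r , t)) es

eliminate-sound : ∀ (es : List (Equation (suc n))) {x} → Solves x (eliminate es) →
                  ∃ λ b → Solves (b ∷ x) es
-- Reached only if there is no pivot, so the free unknown may take any value.
eliminate-sound []                     _        = false , []
eliminate-sound ((false ∷ r , t) ∷ es) (p ∷ ps) =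
  let b , qs = eliminate-sound es ps in b , p ∷ qs
eliminate-sound ((true ∷ r , t) ∷ es) {x} ps    =
  b , back-pivot t (dot r x) ∷ All.map (λ {e} → back e) (All.map⁻ ps)
  where
  b = t xor dot r x

  back-pivot : ∀ t d → (t xor d) xor d ≡ t
  back-pivot t d = trans (xor-assoc t d d) (trans (cong (t xor_) (xor-same d)) (xor-identityʳ t))

  solve-for : ∀ t d s u → d xor s ≡ t xor u → (t xor d) xor s ≡ u
  solve-for false false s u eq = eq
  solve-for false true  s u eq = eq
  solve-for true  false false true eq = refl
  solve-for true  false true false eq = refl
  solve-for true  true  false false eq = refl
  solve-for true  true  true true eq = refl

  back : ∀ e → dot (proj₁ (cancel (r , t) e)) x ≡ proj₂ (cancel (r , t) e) →
         dot (proj₁ e) (b ∷ x) ≡ proj₂ e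
  back (false ∷ s , u) eq = eq
  back (true ∷ s , u)  eq =
    solve-for t (dot r x) (dot s x) u (trans (sym (dot-⊕ r s x)) eq)

solvable : List (Equation n) → Bool
solvable {zero}  []             = true
solvable {zero}  ((_ , t) ∷ es) = not t ∧ solvable es
solvable {suc n} es             = solvable (eliminate es)

solvable-sound : (es : List (Equation n)) → solvable es ≡ true → ∃ λ x → Solves x es
solvable-sound {zero}  []                 _  = [] , []
solvable-sound {zero}  (([] , false) ∷ es) ok with solvable-sound es ok
... | [] , ps = [] , refl ∷ ps
solvable-sound {suc n} es                 ok =
  let x , ps = solvable-sound (eliminate es) ok
      b , qs = eliminate-sound es ps
  in b ∷ x , qs

cancelRow : Vec Bool n → Vec Bool (suc n) → Vec Bool n
cancelRow p (true ∷ r)  = p ⊕ r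
cancelRow p (false ∷ r) = r

eliminateRows : List (Vec Bool (suc n)) → List (Vec Bool n)
eliminateRows []                 = []
eliminateRows ((false ∷ r) ∷ rs) = r ∷ eliminateRows rs
eliminateRows ((true ∷ r) ∷ rs)  = List.map (cancelRow r) rs

eliminateRows-proj₁ : (es : List (Equation (suc n))) →
  eliminateRows (List.map proj₁ es) ≡ List.map proj₁ (eliminate es)
eliminateRows-proj₁ []                     = refl
eliminateRows-proj₁ ((false ∷ r , t) ∷ es) = cong (r ∷_) (eliminateRows-proj₁ es)
eliminateRows-proj₁ ((true ∷ r , t) ∷ es)  = cancelRow-proj₁ es
  where
  cancelRow-proj₁ : ∀ es → List.map (cancelRow r) (List.map proj₁ es) ≡
                           List.map proj₁ (List.map (cancel (r , t)) es)
  cancelRow-proj₁ []                     = refl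
  cancelRow-proj₁ ((true ∷ s , u) ∷ es)  = cong (r ⊕ s ∷_) (cancelRow-proj₁ es)
  cancelRow-proj₁ ((false ∷ s , u) ∷ es) = cong (s ∷_) (cancelRow-proj₁ es)

-- Linear independence: every row must have served as a pivot by the time the columns run out.
independent : List (Vec Bool n) → Bool
independent {zero}  []      = true
independent {zero}  (_ ∷ _) = false
independent {suc n} rs      = independent (eliminateRows rs)

-- No equation survives elimination as `0 = t`, so the right-hand sides are arbitrary.
independent-sound : (es : List (Equation n)) → independent (List.map proj₁ es) ≡ true →
                    ∃ λ x → Solves x es
independent-sound {zero}  [] _  = [] , []
independent-sound {suc n} es ok =
  let x , ps = independent-sound (eliminate es)
                 (trans (cong independent (sym (eliminateRows-proj₁ es))) ok)
      b , qs = eliminate-sound es ps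
  in b ∷ x , qs

-- The linear system for the second bits

_≡ᵇ_ : Bool → Bool → Bool
true  ≡ᵇ b = b
false ≡ᵇ b = not b

≡ᵇ-refl : ∀ b → (b ≡ᵇ b) ≡ true
≡ᵇ-refl true  = refl
≡ᵇ-refl false = refl

-- The equations met by the second bits, once the first bits of the values and
-- of the forbidden values are known: where those agree, the second bits must not.
system : Vec (Vec Bool n) m → Vec (Bool × Bool) m → Vec (Bool × Bool) m → List (Equation n)
system []      []            []            = []
system (r ∷ R) ((a , b) ∷ u) ((d , e) ∷ v) =
  if a ≡ᵇ d then (r , not (b xor e)) ∷ system R u v else system R u v

conflicts : Vec (Vec Bool n) m → Vec Bool m → Vec Bool m → List (Vec Bool n)
conflicts []      []      []      = []
conflicts (r ∷ R) (a ∷ u) (d ∷ v) =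
  if a ≡ᵇ d then r ∷ conflicts R u v else conflicts R u v

-- The coefficients of the system depend on first bits alone, so independence can be tested before
-- the second bits are known.
system-proj₁ : (R : Vec (Vec Bool n) m) (u v : Vec (Bool × Bool) m) →
  List.map proj₁ (system R u v) ≡ conflicts R (Vec.map proj₁ u) (Vec.map proj₁ v)
system-proj₁ []      []            []            = refl
system-proj₁ (r ∷ R) ((a , b) ∷ u) ((d , e) ∷ v) with a ≡ᵇ d
... | true  = cong (r ∷_) (system-proj₁ R u v)
... | false = system-proj₁ R u v

-- The comparison of lengths is only there to skip most eliminations.
good : Vec (Vec Bool n) m → List (Vec Bool m) → Vec Bool m → Bool
good         R []       v = false
good {n = n} R (u ∷ us) v =
  ((length (conflicts R u v) ≤ᵇ n) ∧ independent (conflicts R u v)) ∨ good R us v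

fits : Vec (Vec Bool n) m → List (Vec (Bool × Bool) m) → Vec (Bool × Bool) m → Bool
fits R []       v = false
fits R (u ∷ us) v = solvable (system R u v) ∨ fits R us v

∨-elim : ∀ {a b} → a ∨ b ≡ true → a ≡ true ⊎ b ≡ true
∨-elim {true}  _ = inj₁ refl
∨-elim {false} p = inj₂ p

-- Exhaustive enumeration of bit vectors

vectors : ∀ n → List (Vec Bool n)
vectors zero    = [] ∷ []
vectors (suc n) = List.map (true ∷_) (vectors n) ++ List.map (false ∷_) (vectors n)

forallᵇ : ∀ n → (Vec Bool n → Bool) → Bool
forallᵇ zero    p = p []
forallᵇ (suc n) p = forallᵇ n (p ∘ (false ∷_)) ∧ forallᵇ n (p ∘ (true ∷_))

forallᵇ-sound : ∀ n p → forallᵇ n p ≡ true → ∀ v → p v ≡ true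
forallᵇ-sound zero    p ok []          = ok
forallᵇ-sound (suc n) p ok (false ∷ v) = forallᵇ-sound n (p ∘ (false ∷_)) (∧-conicalˡ _ _ ok) v
forallᵇ-sound (suc n) p ok (true ∷ v)  = forallᵇ-sound n (p ∘ (true ∷_)) (∧-conicalʳ _ _ ok) v

parities : Vec (Vec Bool n) m → Vec Bool n → Vec Bool m
parities R x = Vec.map (λ r → dot r x) R

-- Subset sums in an abelian group

module Combination (Γ : AbelianGroup c ℓ) where

  open AbelianGroup Γ renaming (refl to ≈-refl; sym to ≈-sym; trans to ≈-trans)
  open CommutativeSemigroupProperties commutativeSemigroup using (interchange)

  combination : Vec Bool n → Vec Carrier n → Carrier
  combination []          []      = ε
  combination (true ∷ r)  (a ∷ y) = a ∙ combination r y
  combination (false ∷ r) (a ∷ y) = combination r y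

  combination-∙ : ∀ (r : Vec Bool n) y z →
    combination r (zipWith _∙_ y z) ≈ combination r y ∙ combination r z
  combination-∙ []          []      []      = ≈-sym (identityˡ ε)
  combination-∙ (true ∷ r)  (a ∷ y) (b ∷ z) =
    ≈-trans (∙-congˡ (combination-∙ r y z)) (interchange a b _ _)
  combination-∙ (false ∷ r) (a ∷ y) (b ∷ z) = combination-∙ r y z

  -- Each row stands for an edge and marks the chords whose values that edge sums; `k` lists the
  -- forbidden values of the edges.
  Avoids : Vec (Vec Bool n) m → Vec Carrier m → Vec Carrier n → Set _
  Avoids R k y = Pointwise (λ r a → ¬ combination r y ≈ a) R k

  Avoidable : Vec (Vec Bool n) m → Set _
  Avoidable R = ∀ k → ∃ (Avoids R k)

  Avoids-resp : ∀ (R : Vec (Vec Bool n) m) {k k′ y} →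
                Pointwise _≈_ k k′ → Avoids R k y → Avoids R k′ y
  Avoids-resp []      []       []       = []
  Avoids-resp (r ∷ R) (p ∷ ps) (q ∷ qs) = (λ eq → q (≈-trans eq (≈-sym p))) ∷ Avoids-resp R ps qs

  translate : Vec Carrier n → Vec Bool n → Carrier → Carrier
  translate z r a = a ∙ combination r z ⁻¹

  -- Adding `z` to the chord values adds `combination r z` to the edge with row `r`, so it amounts
  -- to subtracting this from the forbidden value.
  Avoids-translate : ∀ (R : Vec (Vec Bool n) m) k y z →
    Avoids R (zipWith (translate z) R k) y → Avoids R k (zipWith _∙_ y z)
  Avoids-translate []      []      y z []       = []
  Avoids-translate (r ∷ R) (a ∷ k) y z (p ∷ ps) = (λ eq → p (lemma eq)) ∷ Avoids-translate R k y z ps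
    where
    lemma : combination r (zipWith _∙_ y z) ≈ a → combination r y ≈ translate z r a
    lemma eq = begin
      combination r y                                              ≈⟨ identityʳ _ ⟨
      combination r y ∙ ε                                          ≈⟨ ∙-congˡ (inverseʳ _) ⟨
      combination r y ∙ (combination r z ∙ combination r z ⁻¹)     ≈⟨ assoc _ _ _ ⟨
      combination r y ∙ combination r z ∙ combination r z ⁻¹       ≈⟨ ∙-congʳ (combination-∙ r y z) ⟨
      combination r (zipWith _∙_ y z) ∙ combination r z ⁻¹         ≈⟨ ∙-congʳ eq ⟩
      a ∙ combination r z ⁻¹                                       ∎
      where open import Relation.Binary.Reasoning.Setoid setoid

-- The rows of the chords themselves: a chord carries just its own value.
units : ∀ n → Vec (Vec Bool n) n
units zero    = []
units (suc n) = (true ∷ Vec.replicate n false) ∷ Vec.map (false ∷_) (units n)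

module Normalisation (Γ : AbelianGroup c ℓ) where

  open AbelianGroup Γ renaming (refl to ≈-refl; sym to ≈-sym; trans to ≈-trans)
  open Combination Γ

  combination-zero : ∀ (y : Vec Carrier n) → combination (Vec.replicate n false) y ≈ ε
  combination-zero []      = ≈-refl
  combination-zero (a ∷ y) = combination-zero y

  translate-units : ∀ (z : Vec Carrier n) →
    Pointwise _≈_ (zipWith (translate z) (units n) z) (Vec.replicate n ε)
  translate-units []      = []
  translate-units (a ∷ z) =
    ≈-trans (∙-congˡ (⁻¹-cong (≈-trans (∙-congˡ (combination-zero z)) (identityʳ a)))) (inverseʳ a)
    ∷ shift (units _) z (translate-units z)
    where
    shift : ∀ (R : Vec (Vec Bool n) m) {z} w {k : Vec Carrier m} →
      Pointwise _≈_ (zipWith (translate z) R w) k →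
      Pointwise _≈_ (zipWith (translate (a ∷ z)) (Vec.map (false ∷_) R) w) k
    shift []      []      []       = []
    shift (r ∷ R) (b ∷ w) (p ∷ ps) = p ∷ shift R w ps

  -- Translating by a solution of the unit rows makes their forbidden values trivial.
  normalise : (R : Vec (Vec Bool n) t) →
    (∀ k → ∃ (Avoids (units n Vec.++ R) (Vec.replicate n ε Vec.++ k))) →
    Avoidable (units n Vec.++ R)
  normalise {n = n} R hyp k with Vec.splitAt n k
  ... | z , d , refl =
    let y , ok = hyp (zipWith (translate z) R d)
    in zipWith _∙_ y z ,
       Avoids-translate (units n Vec.++ R) (z Vec.++ d) y z
         (Avoids-resp (units n Vec.++ R) (approx (units n) z (translate-units z)) ok)
    where
    approx : ∀ (U : Vec (Vec Bool n) m) w {k : Vec Carrier m} →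
      Pointwise _≈_ (zipWith (translate z) U w) k →
      Pointwise _≈_ (k Vec.++ zipWith (translate z) R d)
                    (zipWith (translate z) (U Vec.++ R) (w Vec.++ d))
    approx []      []      []       = Pointwise.refl ≈-refl
    approx (r ∷ U) (a ∷ w) (p ∷ ps) = ≈-sym p ∷ approx U w ps

-- Γ as an extension of ℤ/2 by ℤ/2: coset is the quotient map, τ generates its
-- kernel, σ represents the other coset, and bit tells x from x ∙ τ.
record Extension (Γ : AbelianGroup c ℓ) : Set (c ⊔ ℓ) where
  open AbelianGroup Γ
  field
    σ τ        : Carrier
    coset bit  : Carrier → Bool
    coset-cong : ∀ {x y} → x ≈ y → coset x ≡ coset y
    bit-cong   : ∀ {x y} → x ≈ y → bit x ≡ bit y
    coset-∙    : ∀ x y → coset (x ∙ y) ≡ coset x xor coset y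
    coset-σ    : coset σ ≡ true
    coset-τ    : coset τ ≡ false
    bit-τ      : ∀ x → bit (x ∙ τ) ≡ not (bit x)
    τ∙τ        : τ ∙ τ ≈ ε

-- Lifting a choice of images from the quotient to the group

module Lifting {Γ : AbelianGroup c ℓ} (E : Extension Γ) where

  open AbelianGroup Γ renaming (refl to ≈-refl; sym to ≈-sym; trans to ≈-trans)
  open Extension E
  open Combination Γ
  open CommutativeSemigroupProperties commutativeSemigroup using (interchange)

  _·_ : Bool → Carrier → Carrier
  b · γ = if b then γ else ε

  coset-ε : coset ε ≡ false
  coset-ε = trans (coset-cong (≈-sym (identityˡ ε))) (trans (coset-∙ ε ε) (xor-same (coset ε)))

  coset-·σ : ∀ b → coset (b · σ) ≡ b
  coset-·σ true  = coset-σ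
  coset-·σ false = coset-ε

  coset-·τ : ∀ x b → coset (x ∙ b · τ) ≡ coset x
  coset-·τ x b = trans (coset-∙ x _) (trans (cong (coset x xor_) (kernel b)) (xor-identityʳ _))
    where
    kernel : ∀ b → coset (b · τ) ≡ false
    kernel true  = coset-τ
    kernel false = coset-ε

  bit-·τ : ∀ x b → bit (x ∙ b · τ) ≡ bit x xor b
  bit-·τ x true  = trans (bit-τ x) (sym (trans (xor-comm (bit x) true) refl))
  bit-·τ x false = trans (bit-cong (identityʳ x)) (sym (xor-identityʳ _))

  ·τ-xor : ∀ a b → a · τ ∙ b · τ ≈ (a xor b) · τ
  ·τ-xor true  true  = τ∙τ
  ·τ-xor true  false = identityʳ τ
  ·τ-xor false b     = identityˡ _

  code : Carrier → Bool × Bool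
  code x = coset x , bit x

  lift : Vec Bool n → Vec Bool n → Vec Carrier n
  lift = zipWith (λ a b → a · σ ∙ b · τ)

  base : Vec Bool n → Vec Bool n → Carrier
  base x r = combination r (Vec.map (_· σ) x)

  coset-base : ∀ (x r : Vec Bool n) → coset (base x r) ≡ dot r x
  coset-base []      []          = coset-ε
  coset-base (b ∷ x) (true ∷ r)  = trans (coset-∙ _ _) (cong₂ _xor_ (coset-·σ b) (coset-base x r))
  coset-base (b ∷ x) (false ∷ r) = coset-base x r

  -- The multiples of `τ` add up over 𝔽₂ since `τ ∙ τ ≈ ε`. Carries between the multiples of `σ`,
  -- such as 1 + 1 = 2 in ℤ/4, stay inside `base x r`, which does not involve `z`.
  combination-lift : ∀ (r x z : Vec Bool n) → combination r (lift x z) ≈ base x r ∙ dot r z · τ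
  combination-lift []          []      []      = ≈-sym (identityˡ ε)
  combination-lift (true ∷ r)  (a ∷ x) (b ∷ z) =
    ≈-trans (∙-congˡ (combination-lift r x z))
      (≈-trans (interchange _ _ _ _) (∙-congˡ (·τ-xor b (dot r z))))
  combination-lift (false ∷ r) (a ∷ x) (b ∷ z) = combination-lift r x z

  values : Vec (Vec Bool n) m → Vec Bool n → Vec (Bool × Bool) m
  values R x = Vec.map (λ r → code (base x r)) R

  values-proj₁ : ∀ (R : Vec (Vec Bool n) m) x → Vec.map proj₁ (values R x) ≡ parities R x
  values-proj₁ []      x = refl
  values-proj₁ (r ∷ R) x = cong₂ _∷_ (coset-base x r) (values-proj₁ R x)

  -- Different cosets separate the sum from the forbidden value. In equal cosets the equation makes
  -- the bit of the sum the opposite of the forbidden bit.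
  lift-sound : ∀ (R : Vec (Vec Bool n) m) k x {z} → Solves z (system R (values R x) (Vec.map code k)) →
               Avoids R k (lift x z)
  lift-sound []      []      x     _  = []
  lift-sound (r ∷ R) (a ∷ k) x {z} ps
    with coset (base x r) ≡ᵇ coset a in agree | ps
  ... | false | ps     = differ ∷ lift-sound R k x ps
    where
    differ : ¬ combination r (lift x z) ≈ a
    differ eq = contradiction (trans (sym agree) (trans (cong (_≡ᵇ coset a) same) (≡ᵇ-refl (coset a)))) λ ()
      where
      same : coset (base x r) ≡ coset a
      same = trans (sym (coset-·τ _ (dot r z)))
                   (coset-cong (≈-trans (≈-sym (combination-lift r x z)) eq))
  ... | true  | p ∷ ps = differ ∷ lift-sound R k x ps
    where
    flip : ∀ a b → a xor not (a xor b) ≢ b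
    flip false false ()
    flip false true  ()
    flip true  false ()
    flip true  true  ()

    differ : ¬ combination r (lift x z) ≈ a
    differ eq = flip (bit (base x r)) (bit a)
      (trans (cong (bit (base x r) xor_) (sym p))
        (trans (sym (bit-·τ _ (dot r z)))
               (bit-cong (≈-trans (≈-sym (combination-lift r x z)) eq))))

  map-code-coset : ∀ (k : Vec Carrier m) → Vec.map proj₁ (Vec.map code k) ≡ Vec.map coset k
  map-code-coset []      = refl
  map-code-coset (a ∷ k) = cong (coset a ∷_) (map-code-coset k)

  good-sound : ∀ (R : Vec (Vec Bool n) m) xs k →
    good R (List.map (parities R) xs) (Vec.map coset k) ≡ true → ∃ (Avoids R k)
  good-sound {n = n} R (x ∷ xs) k ok with ∨-elim ok
  ... | inj₂ ok′ = good-sound R xs k ok′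
  ... | inj₁ ok′ =
    let z , solves = independent-sound (system R (values R x) (Vec.map code k))
          (trans (cong independent (trans (system-proj₁ R (values R x) (Vec.map code k))
                   (cong₂ (conflicts R) (values-proj₁ R x) (map-code-coset k))))
                 (∧-conicalʳ _ _ ok′))
    in lift x z , lift-sound R k x solves

  fits-sound : ∀ (R : Vec (Vec Bool n) m) xs k →
    fits R (List.map (values R) xs) (Vec.map code k) ≡ true → ∃ (Avoids R k)
  fits-sound R (x ∷ xs) k ok with ∨-elim ok
  ... | inj₂ ok′ = fits-sound R xs k ok′
  ... | inj₁ ok′ =
    let z , solves = solvable-sound (system R (values R x) (Vec.map code k)) ok′
    in lift x z , lift-sound R k x solves

-- Flows and circulations

count : (Fin m → Bool) → ℕ
count {zero}  b = 0
count {suc m} b = if b zero then suc (count (b ∘ suc)) else count (b ∘ suc)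

-- An integer flow with values 0 and 1. It is checked by counting, independently of any group, and
-- any group element can then be sent along it.
Circulation : Digraph n m → (Fin m → Bool) → Set
Circulation D b = ∀ v → count (λ e → ⌊ target e ≟ v ⌋ ∧ b e) ≡ count (λ e → ⌊ source e ≟ v ⌋ ∧ b e)
  where open Digraph D

module Flows (Γ : AbelianGroup c ℓ) (D : Digraph n m) where

  open AbelianGroup Γ renaming (refl to ≈-refl; sym to ≈-sym; trans to ≈-trans)
  open RawMonoid rawMonoid using () renaming (_×_ to _×ᴳ_)
  open Sum commutativeMonoid using (sum; sum-cong-≋; ∑-distrib-+; sum-replicate-zero)
  open Combination Γ
  open Digraph D

  sum-indicator : ∀ {m} (b : Fin m → Bool) γ → sum (λ e → if b e then γ else ε) ≈ count b ×ᴳ γ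
  sum-indicator {zero}  b γ = ≈-refl
  sum-indicator {suc m} b γ with b zero
  ... | true  = ∙-congˡ (sum-indicator (b ∘ suc) γ)
  ... | false = ≈-trans (identityˡ _) (sum-indicator (b ∘ suc) γ)

  flow-through : (φ : Fin m → Carrier) (end : Fin m → Fin n) (v : Fin n) → Carrier
  flow-through φ end v = sum (λ e → if ⌊ end e ≟ v ⌋ then φ e else ε)

  through-cong : ∀ {φ ψ} end v → (∀ e → φ e ≈ ψ e) → flow-through φ end v ≈ flow-through ψ end v
  through-cong end v eq = sum-cong-≋ λ e → if-cong ⌊ end e ≟ v ⌋ (eq e)
    where
    if-cong : ∀ b {x y} → x ≈ y → (if b then x else ε) ≈ (if b then y else ε)
    if-cong true  p = p
    if-cong false p = ≈-refl

  through-∙ : ∀ φ ψ end v →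
    flow-through (λ e → φ e ∙ ψ e) end v ≈ flow-through φ end v ∙ flow-through ψ end v
  through-∙ φ ψ end v =
    ≈-trans (sum-cong-≋ λ e → if-∙ ⌊ end e ≟ v ⌋ (φ e) (ψ e)) 
      (∑-distrib-+ (λ e → if ⌊ end e ≟ v ⌋ then φ e else ε) (λ e → if ⌊ end e ≟ v ⌋ then ψ e else ε))
    where
    if-∙ : ∀ b x y → (if b then x ∙ y else ε) ≈ (if b then x else ε) ∙ (if b then y else ε)
    if-∙ true  x y = ≈-refl
    if-∙ false x y = ≈-sym (identityˡ ε)

  through-indicator : ∀ (b : Fin m → Bool) γ end v →
    flow-through (λ e → if b e then γ else ε) end v ≈ count (λ e → ⌊ end e ≟ v ⌋ ∧ b e) ×ᴳ γ
  through-indicator b γ end v =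
    ≈-trans (sum-cong-≋ λ e → reflexive (if-∧ ⌊ end e ≟ v ⌋ (b e)))
      (sum-indicator (λ e → ⌊ end e ≟ v ⌋ ∧ b e) γ)
    where
    if-∧ : ∀ a b → (if a then (if b then γ else ε) else ε) ≡ (if a ∧ b then γ else ε)
    if-∧ true  b = refl
    if-∧ false b = refl

  circulation-flow : ∀ {b} → Circulation D b → ∀ γ → IsFlow Γ D (λ e → if b e then γ else ε)
  circulation-flow {b} balanced γ v =
    ≈-trans (through-indicator b γ target v)
      (≈-trans (reflexive (cong (_×ᴳ γ) (balanced v))) (≈-sym (through-indicator b γ source v)))

  combination-flow : ∀ (col : Fin β → Fin m → Bool) → (∀ j → Circulation D (col j)) →
                     ∀ y → IsFlow Γ D (λ e → combination (tabulate (λ j → col j e)) y)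
  combination-flow col balanced [] v = ≈-trans (vanish target) (≈-sym (vanish source))
    where
    vanish : ∀ end → flow-through (λ _ → ε) end v ≈ ε
    vanish end = ≈-trans (sum-cong-≋ λ e → reflexive (if-ε ⌊ end e ≟ v ⌋)) (sum-replicate-zero m)
      where
      if-ε : ∀ b → (if b then ε else ε) ≡ ε
      if-ε true  = refl
      if-ε false = refl
  combination-flow col balanced (γ ∷ y) v =
    ≈-trans (split target)
      (≈-trans (∙-cong (circulation-flow (balanced zero) γ v)
                       (combination-flow (col ∘ suc) (balanced ∘ suc) y v))
               (≈-sym (split source)))
    where
    split : ∀ end → flow-through (λ e → combination (tabulate (λ j → col j e)) (γ ∷ y)) end v ≈
                    flow-through (λ e → if col zero e then γ else ε) end v ∙
                    flow-through (λ e → combination (tabulate (λ j → col (suc j) e)) y) end v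
    split end = ≈-trans (through-cong end v λ e → uncons (col zero e) _)
      (through-∙ (λ e → if col zero e then γ else ε)
                 (λ e → combination (tabulate (λ j → col (suc j) e)) y) end v)
      where
      uncons : ∀ b r → combination (b ∷ r) (γ ∷ y) ≈ (if b then γ else ε) ∙ combination r y
      uncons true  r = ≈-refl
      uncons false r = ≈-sym (identityˡ _)

  -- The columns of `R` are circulations and `y` gives their weights; the weighted sum is a flow
  -- whose value on an edge is read off the row of that edge.
  avoidable⇒connected : (R : Vec (Vec Bool β) m) →
    (∀ j → Circulation D (λ e → lookup (lookup R e) j)) → Avoidable R → DigraphConnected Γ D
  avoidable⇒connected R balanced avoid h =
    let y , avoids = avoid (tabulate h)
    in (λ e → combination (tabulate (lookup (lookup R e))) y) ,
       combination-flow (λ j e → lookup (lookup R e) j) balanced y ,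
       λ e eq → Pointwise.lookup avoids e
         (≈-trans (reflexive (cong (λ r → combination r y) (sym (tabulate∘lookup (lookup R e)))))
           (≈-trans eq (reflexive (sym (lookup∘tabulate h e)))))

circulations? : (D : Digraph n m) (R : Vec (Vec Bool β) m) →
                Dec (∀ j → Circulation D (λ e → lookup (lookup R e) j))
circulations? D R = all? λ j → all? λ v → _ ℕ.≟ _

-- Refuting connectivity

⁅⁆∪⁅⁆-injective : ∀ {a b x y : Fin n} → x ≢ y → ⁅ a ⁆ ∪ ⁅ b ⁆ ≡ ⁅ x ⁆ ∪ ⁅ y ⁆ →
                  (a ≡ x × b ≡ y) ⊎ (a ≡ y × b ≡ x)
⁅⁆∪⁅⁆-injective {a = a} {b} {x} {y} x≢y eq
  with x∈p∪q⁻ ⁅ a ⁆ ⁅ b ⁆ (subst (x ∈_) (sym eq) (x∈p∪q⁺ (inj₁ (x∈⁅x⁆ x))))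
     | x∈p∪q⁻ ⁅ a ⁆ ⁅ b ⁆ (subst (y ∈_) (sym eq) (x∈p∪q⁺ (inj₂ (x∈⁅x⁆ y))))
... | inj₁ x∈a | inj₂ y∈b = inj₁ (sym (x∈⁅y⁆⇒x≡y a x∈a) , sym (x∈⁅y⁆⇒x≡y b y∈b))
... | inj₂ x∈b | inj₁ y∈a = inj₂ (sym (x∈⁅y⁆⇒x≡y a y∈a) , sym (x∈⁅y⁆⇒x≡y b x∈b))
... | inj₁ x∈a | inj₁ y∈a = contradiction (trans (x∈⁅y⁆⇒x≡y a x∈a) (sym (x∈⁅y⁆⇒x≡y a y∈a))) x≢y
... | inj₂ x∈b | inj₂ y∈b = contradiction (trans (x∈⁅y⁆⇒x≡y b x∈b) (sym (x∈⁅y⁆⇒x≡y b y∈b))) x≢y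

Arc : ℕ → Set
Arc n = Fin n × Fin n

digraph : Vec (Arc n) m → Digraph n m
digraph es = record { source = proj₁ ∘ lookup es ; target = proj₂ ∘ lookup es }

endpoints : Arc n → Subset n
endpoints (s , t) = ⁅ s ⁆ ∪ ⁅ t ⁆

module Refutation
  (Γ : AbelianGroup c ℓ)
  (_≈?_ : Decidable (AbelianGroup._≈_ Γ))
  (elements : List (AbelianGroup.Carrier Γ))
  (complete : ∀ x → Any (AbelianGroup._≈_ Γ x) elements)
  where

  open AbelianGroup Γ renaming (refl to ≈-refl; sym to ≈-sym; trans to ≈-trans)
  open AbelianGroupProperties Γ using (⁻¹-∙-comm; ε⁻¹≈ε; ⁻¹-involutive; x≈y⇒x∙y⁻¹≈ε)
  open Sum commutativeMonoid using (sum; sum-cong-≋; ∑-distrib-+)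

  at : Bool → Carrier → Carrier
  at b a = if b then a else ε

  net : Arc n → Carrier → Fin n → Carrier
  net (s , t) a v = at ⌊ t ≟ v ⌋ a ∙ at ⌊ s ≟ v ⌋ a ⁻¹

  at-⁻¹ : ∀ b a → at b (a ⁻¹) ≈ at b a ⁻¹
  at-⁻¹ true  a = ≈-refl
  at-⁻¹ false a = ≈-sym ε⁻¹≈ε

  at-cong : ∀ b {x y} → x ≈ y → at b x ≈ at b y
  at-cong true  p = p
  at-cong false p = ≈-refl

  net-cong : ∀ (e : Arc n) {x y} → x ≈ y → ∀ v → net e x v ≈ net e y v
  net-cong (s , t) p v = ∙-cong (at-cong ⌊ t ≟ v ⌋ p) (⁻¹-cong (at-cong ⌊ s ≟ v ⌋ p))

  net-swap : ∀ (s t : Fin n) a v → net (t , s) (a ⁻¹) v ≈ net (s , t) a v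
  net-swap s t a v = ≈-trans (comm _ _) (∙-cong (unflip ⌊ t ≟ v ⌋) (at-⁻¹ ⌊ s ≟ v ⌋ a))
    where
    unflip : ∀ b → at b (a ⁻¹) ⁻¹ ≈ at b a
    unflip true  = ⁻¹-involutive a
    unflip false = ε⁻¹≈ε

  excess : Vec (Arc n) m → (Fin m → Carrier) → Fin n → Carrier
  excess es φ v = sum (λ e → net (lookup es e) (φ e) v)

  -- Counting outflow negatively turns conservation into a single sum over the arcs, which a search
  -- can accumulate arc by arc.
  flow⇒excess : ∀ (D : Digraph n m) {φ} → IsFlow Γ D φ → let open Digraph D in
                ∀ v → sum (λ e → net (source e , target e) (φ e) v) ≈ ε
  flow⇒excess D {φ} flow v =
    ≈-trans (∑-distrib-+ (λ e → at ⌊ target e ≟ v ⌋ (φ e)) (λ e → at ⌊ source e ≟ v ⌋ (φ e) ⁻¹))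
      (≈-trans (∙-congˡ (sum-⁻¹ (λ e → at ⌊ source e ≟ v ⌋ (φ e)))) (x≈y⇒x∙y⁻¹≈ε (flow v)))
    where
    open Digraph D
    sum-⁻¹ : ∀ {m} (f : Fin m → Carrier) → sum (λ e → f e ⁻¹) ≈ sum f ⁻¹
    sum-⁻¹ {zero}  f = ≈-sym ε⁻¹≈ε
    sum-⁻¹ {suc m} f = ≈-trans (∙-congˡ (sum-⁻¹ (f ∘ suc))) (⁻¹-∙-comm _ _)

  push : Arc n → Carrier → Vec Carrier n → Vec Carrier n
  push (s , t) a x = Vec.updateAt (Vec.updateAt x s (_∙ a ⁻¹)) t (_∙ a)

  lookup-updateAt : ∀ (x : Vec Carrier n) i a v →
    lookup (Vec.updateAt x i (_∙ a)) v ≈ lookup x v ∙ at ⌊ i ≟ v ⌋ a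
  lookup-updateAt x i a v with i ≟ v
  ... | yes refl = reflexive (lookup∘updateAt i x)
  ... | no  i≢v  = ≈-trans (reflexive (lookup∘updateAt′ v i (i≢v ∘ sym) x)) (≈-sym (identityʳ _))

  lookup-push : ∀ e a (x : Vec Carrier n) v → lookup (push e a x) v ≈ lookup x v ∙ net e a v
  lookup-push (s , t) a x v = begin
    lookup (push (s , t) a x) v                           ≈⟨ lookup-updateAt (Vec.updateAt x s (_∙ a ⁻¹)) t a v ⟩
    lookup (Vec.updateAt x s (_∙ a ⁻¹)) v ∙ at ⌊ t ≟ v ⌋ a  ≈⟨ ∙-congʳ (lookup-updateAt x s (a ⁻¹) v) ⟩
    lookup x v ∙ at ⌊ s ≟ v ⌋ (a ⁻¹) ∙ at ⌊ t ≟ v ⌋ a       ≈⟨ assoc _ _ _ ⟩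
    lookup x v ∙ (at ⌊ s ≟ v ⌋ (a ⁻¹) ∙ at ⌊ t ≟ v ⌋ a)     ≈⟨ ∙-congˡ (comm _ _) ⟩
    lookup x v ∙ (at ⌊ t ≟ v ⌋ a ∙ at ⌊ s ≟ v ⌋ (a ⁻¹))     ≈⟨ ∙-congˡ (∙-congˡ (at-⁻¹ ⌊ s ≟ v ⌋ a)) ⟩
    lookup x v ∙ net (s , t) a v                          ∎
    where
    open import Relation.Binary.Reasoning.Setoid setoid

  untouched : Fin n → Vec (Arc n) m → Bool
  untouched v []             = true
  untouched v ((s , t) ∷ es) = not ⌊ s ≟ v ⌋ ∧ not ⌊ t ≟ v ⌋ ∧ untouched v es

  untouched-excess : ∀ v (es : Vec (Arc n) m) φ → untouched v es ≡ true → excess es φ v ≈ ε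
  untouched-excess v []             φ _ = ≈-refl
  untouched-excess v ((s , t) ∷ es) φ p with s ≟ v | t ≟ v
  ... | no _ | no _ =
    ≈-trans (∙-cong (≈-trans (identityˡ _) ε⁻¹≈ε) (untouched-excess v es (φ ∘ suc) p)) (identityˡ ε)

  nonzero : Vec Carrier n → Bool
  nonzero []      = false
  nonzero (a ∷ x) = not ⌊ a ≈? ε ⌋ ∨ nonzero x

  nonzero-sound : ∀ (x : Vec Carrier n) → nonzero x ≡ true → ¬ (∀ v → lookup x v ≈ ε)
  nonzero-sound (a ∷ x) p zeros with a ≈? ε
  ... | yes _   = nonzero-sound x p (zeros ∘ suc)
  ... | no  a≉ε = a≉ε (zeros zero)

  -- Once no remaining arc meets `v`, a nonzero net inflow there cannot be cancelled. The search
  -- tests only the tail of the latest arc: with the chords placed first, the path arc from i to i +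
  -- 1 is the last arc at i.
  stuck : Fin n → Vec (Arc n) m → Vec Carrier n → Bool
  stuck v es x = not ⌊ lookup x v ≈? ε ⌋ ∧ untouched v es

  -- x is the net inflow along the edges processed so far.
  refute      : Vec (Arc n) m → Vec Carrier m → Vec Carrier n → Bool
  refuteAfter : Fin n → Vec (Arc n) m → Vec Carrier m → Vec Carrier n → Bool
  refute []       []      x = nonzero x
  refute (e ∷ es) (h ∷ k) x = all (λ a → ⌊ a ≈? h ⌋ ∨ refuteAfter (proj₁ e) es k (push e a x)) elements
  refuteAfter v es k x = stuck v es x ∨ refute es k x

  all-complete : ∀ (p : Carrier → Bool) → all p elements ≡ true → ∀ x → ∃ λ y → x ≈ y × p y ≡ true
  all-complete p ok x = go elements ok (complete x)
    where
    go : ∀ ys → all p ys ≡ true → Any (x ≈_) ys → ∃ λ y → x ≈ y × p y ≡ true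
    go (y ∷ ys) ok (here eq)  = y , eq , ∧-conicalˡ _ _ ok
    go (y ∷ ys) ok (there ∈ys) = go ys (∧-conicalʳ (p y) _ ok) ∈ys

  push-conserved : ∀ e (es : Vec (Arc n) m) x φ {a} → φ zero ≈ a → ∀ {v} →
    lookup x v ∙ excess (e ∷ es) φ v ≈ ε → lookup (push e a x) v ∙ excess es (φ ∘ suc) v ≈ ε
  push-conserved e es x φ {a} φ₀≈a {v} conserved =
    ≈-trans (∙-congʳ (≈-trans (lookup-push e a x v) (∙-congˡ (net-cong e (≈-sym φ₀≈a) v))))
      (≈-trans (assoc _ _ _) conserved)

  stuck-sound : ∀ v (es : Vec (Arc n) m) x → stuck v es x ≡ true →
                ∀ φ → ¬ lookup x v ∙ excess es φ v ≈ ε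
  stuck-sound v es x ok φ conserved with lookup x v ≈? ε
  ... | no x≉ε = x≉ε (≈-trans (≈-sym (identityʳ _))
                   (≈-trans (∙-congˡ (≈-sym (untouched-excess v es φ ok))) conserved))

  -- Invariant of the search: at each vertex the inflow accumulated in `x` and the contribution of
  -- the remaining arcs cancel.
  refute-sound : ∀ (es : Vec (Arc n) m) k x → refute es k x ≡ true →
    ∀ φ → (∀ e → ¬ φ e ≈ lookup k e) → ¬ (∀ v → lookup x v ∙ excess es φ v ≈ ε)
  refute-sound []       []      x ok φ avoids conserved =
    nonzero-sound x ok λ v → ≈-trans (≈-sym (identityʳ _)) (conserved v)
  refute-sound (e ∷ es) (h ∷ k) x ok φ avoids conserved
    with all-complete (λ a → ⌊ a ≈? h ⌋ ∨ refuteAfter (proj₁ e) es k (push e a x)) ok (φ zero)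
  ... | a , φ₀≈a , ok′ with a ≈? h
  ...   | yes a≈h = avoids zero (≈-trans φ₀≈a a≈h)
  ...   | no  _   with ∨-elim ok′
  ...     | inj₂ ok″ = refute-sound es k (push e a x) ok″ (φ ∘ suc) (avoids ∘ suc)
                         λ v → push-conserved e es x φ φ₀≈a (conserved v)
  ...     | inj₁ ok″ = stuck-sound (proj₁ e) es (push e a x) ok″ (φ ∘ suc) 
                         (push-conserved e es x φ φ₀≈a (conserved (proj₁ e)))
  -- `Connected` supplies its own orientation, while the search uses a fixed one. Reversing an arc
  -- inverts both its value and its forbidden value.
  reorient : ∀ {e e′ : Arc n} → proj₁ e′ ≢ proj₂ e′ → endpoints e ≡ endpoints e′ → ∀ k → ∃ λ k′ →
             ∀ a → ¬ a ≈ k′ → ∃ λ a′ → ¬ a′ ≈ k × (∀ v → net e′ a′ v ≈ net e a v)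
  reorient s≢t eq k with ⁅⁆∪⁅⁆-injective s≢t eq
  ... | inj₁ (refl , refl) = k , λ a a≉k → a , a≉k , λ v → ≈-refl
  reorient {e = s , t} s≢t eq k
      | inj₂ (refl , refl) = k ⁻¹ , λ a a≉k⁻¹ → a ⁻¹ ,
    (λ eq → a≉k⁻¹ (≈-trans (≈-sym (⁻¹-involutive a)) (⁻¹-cong eq))) , net-swap s t a

  refute⇒¬connected : ∀ (G : Graph n m) (es : Vec (Arc n) m) → digraph es IsOrientationOf G →
    (∀ e → proj₁ (lookup es e) ≢ proj₂ (lookup es e)) →
    ∀ k → refute es k (Vec.replicate n ε) ≡ true → ¬ Connected Γ G
  refute⇒¬connected {n = n} G es orients loopless k ok (D , orientsD , connected) =
    refute-sound es k (Vec.replicate n ε) ok (λ e → proj₁ (back e)) (λ e → proj₁ (proj₂ (back e)))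
      λ v → ≈-trans (∙-congʳ (reflexive (lookup-replicate v ε)))
        (≈-trans (identityˡ _)
          (≈-trans (sum-cong-≋ λ e → proj₂ (proj₂ (back e)) v) (flow⇒excess D flow v)))
    where
    open Digraph D
    turn : ∀ e → _
    turn e = reorient {e = source e , target e} {lookup es e} (loopless e)
                      (trans (orientsD e) (sym (orients e))) (lookup k e)
    -- The flow is requested for the forbidden values transported to the orientation `D`.
    φ = proj₁ (connected (λ e → proj₁ (turn e)))
    flow = proj₁ (proj₂ (connected (λ e → proj₁ (turn e))))
    back : ∀ e → _
    back e = proj₂ (turn e) (φ e) (proj₂ (proj₂ (connected (λ e → proj₁ (turn e)))) e)

-- Verified search

_≟ᵛ_ : DecidableEquality (Vec Bool n)
_≟ᵛ_ = ≡-dec _≟ᵇ_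

zeros : ∀ n → Vec Bool n
zeros n = Vec.replicate n false

goodOr : Vec (Vec Bool β) (β + t) → List (Vec Bool (β + t)) →
         Vec Bool t → Vec Bool t → Vec Bool t → Bool
goodOr {β = β} R us b₁ b₂ v = good R us (zeros β Vec.++ v) ∨ (⌊ v ≟ᵛ b₁ ⌋ ∨ ⌊ v ≟ᵛ b₂ ⌋)

fitsBits : Vec (Vec Bool β) (β + t) → List (Vec (Bool × Bool) (β + t)) →
           Vec Bool t → Vec Bool t → Bool
fitsBits {β = β} R us v w = fits R us (Vec.zip (zeros β Vec.++ v) (zeros β Vec.++ w))

goodOrFits : Vec (Vec Bool β) (β + t) → List (Vec Bool (β + t)) → List (Vec (Bool × Bool) (β + t)) →
             Vec Bool t → Bool
goodOrFits {β = β} {t = t} R us ws v = good R us (zeros β Vec.++ v) ∨ forallᵇ t (fitsBits R ws v)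

module Search (Γ : AbelianGroup c ℓ) (R : Vec (Vec Bool β) t) where

  open AbelianGroup Γ using (Carrier; ε; _≈_)
  open Combination Γ
  open Normalisation Γ

  rows = units β Vec.++ R

  table = List.map (parities rows) (vectors β)

  Good : Vec Bool t → Set
  Good v = good rows table (zeros β Vec.++ v) ≡ true

  map-normal : ∀ {A : Set} (f : Carrier → A) {a} → f ε ≡ a → ∀ (k : Vec Carrier t) →
    Vec.map f (Vec.replicate β ε Vec.++ k) ≡ Vec.replicate β a Vec.++ Vec.map f k
  map-normal f eq k = trans (map-++ f (Vec.replicate β ε) k)
    (cong (Vec._++ Vec.map f k) (trans (map-replicate f ε β) (cong (Vec.replicate β) eq)))

  Solution : Vec Carrier t → Set _
  Solution k = ∃ (Avoids rows (Vec.replicate β ε Vec.++ k))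

  good⇒solution : (E : Extension Γ) → ∀ k → Good (Vec.map (Extension.coset E) k) → Solution k
  good⇒solution E k ok = good-sound rows (vectors β) (Vec.replicate β ε Vec.++ k)
    (trans (cong (good rows table) (map-normal coset coset-ε k)) ok)
    where
    open Extension E
    open Lifting E

  -- If the first two quotients see bad patterns, the third sees their sum, which the last four
  -- hypotheses make good.
  avoidable-by-three :
    (E₁ E₂ E₃ : Extension Γ) →
    (∀ x → Extension.coset E₃ x ≡ Extension.coset E₁ x xor Extension.coset E₂ x) →
    (b₁ b₂ : Vec Bool t) →
    forallᵇ t (goodOr rows table b₁ b₂) ≡ true →
    Good (b₁ ⊕ b₁) → Good (b₁ ⊕ b₂) → Good (b₂ ⊕ b₁) → Good (b₂ ⊕ b₂) →
    Avoidable rows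
  avoidable-by-three E₁ E₂ E₃ coset-xor b₁ b₂ ok g₁₁ g₁₂ g₂₁ g₂₂ = normalise R solve
    where
    open Extension

    check : ∀ v → Good v ⊎ (v ≡ b₁ ⊎ v ≡ b₂)
    check v with ∨-elim {good rows table (zeros β Vec.++ v)}
                   (forallᵇ-sound t (goodOr rows table b₁ b₂) ok v)
    ... | inj₁ g = inj₁ g
    ... | inj₂ _ with v ≟ᵛ b₁ | v ≟ᵛ b₂
    ...   | yes p | _     = inj₂ (inj₁ p)
    ...   | no _  | yes p = inj₂ (inj₂ p)

    third : ∀ k {u v} → Vec.map (coset E₁) k ≡ u → Vec.map (coset E₂) k ≡ v →
            Good (u ⊕ v) → Solution k
    third k p q g = good⇒solution E₃ k (subst Good (sym (trans (map-xor k) (cong₂ _⊕_ p q))) g)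
      where
      map-xor : ∀ {m} (k : Vec Carrier m) →
        Vec.map (coset E₃) k ≡ Vec.map (coset E₁) k ⊕ Vec.map (coset E₂) k
      map-xor []      = refl
      map-xor (a ∷ k) = cong₂ _∷_ (coset-xor a) (map-xor k)

    solve : ∀ k → Solution k
    solve k with check (Vec.map (coset E₁) k) | check (Vec.map (coset E₂) k)
    ... | inj₁ g        | _             = good⇒solution E₁ k g
    ... | inj₂ _        | inj₁ g        = good⇒solution E₂ k g
    ... | inj₂ (inj₁ p) | inj₂ (inj₁ q) = third k p q g₁₁
    ... | inj₂ (inj₁ p) | inj₂ (inj₂ q) = third k p q g₁₂
    ... | inj₂ (inj₂ p) | inj₂ (inj₁ q) = third k p q g₂₁
    ... | inj₂ (inj₂ p) | inj₂ (inj₂ q) = third k p q g₂₂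

  -- Since `bit ε` is `false`, trivial forbidden values on the chords have both bits zero, as
  -- `fitsBits` assumes.
  avoidable-by-bits :
    (E : Extension Γ) → Extension.bit E ε ≡ false →
    forallᵇ t (goodOrFits rows table
                               (List.map (Lifting.values E rows) (vectors β))) ≡ true →
    Avoidable rows
  avoidable-by-bits E bit-ε ok = normalise R solve
    where
    open Extension E
    open Lifting E

    zip-code : ∀ {m} (k : Vec Carrier m) → Vec.zip (Vec.map coset k) (Vec.map bit k) ≡ Vec.map code k
    zip-code []      = refl
    zip-code (a ∷ k) = cong (code a ∷_) (zip-code k)

    solve : ∀ k → Solution k
    solve k with ∨-elim {good rows table (zeros β Vec.++ Vec.map coset k)}
                   (forallᵇ-sound t (goodOrFits rows table
                                                     (List.map (values rows) (vectors β))) ok (Vec.map coset k))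
    ... | inj₁ g   = good⇒solution E k g
    ... | inj₂ ok′ = fits-sound rows (vectors β) (Vec.replicate β ε Vec.++ k)
      (trans (cong (fits rows (List.map (values rows) (vectors β))) codes)
        (forallᵇ-sound t (fitsBits rows (List.map (values rows) (vectors β)) (Vec.map coset k))
                       ok′ (Vec.map bit k)))
      where
      codes : Vec.map code (Vec.replicate β ε Vec.++ k) ≡
              Vec.zip (zeros β Vec.++ Vec.map coset k) (zeros β Vec.++ Vec.map bit k)
      codes = sym (trans (cong₂ Vec.zip (sym (map-normal coset coset-ε k)) (sym (map-normal bit bit-ε k)))
                         (zip-code (Vec.replicate β ε Vec.++ k)))

-- The two graphs

-- The kernel is {0, 2}. Here `bit`, the higher binary digit, is not a homomorphism, as 1 + 1 = 2
-- shows.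
ℤ₄-extension : Extension ℤ₄
ℤ₄-extension = record
  { σ = 1F
  ; τ = 2F
  ; coset = λ { 0F → false ; 1F → true ; 2F → false ; 3F → true }
  ; bit = λ { 0F → false ; 1F → false ; 2F → true ; 3F → true }
  ; coset-cong = λ { refl → refl }
  ; bit-cong = λ { refl → refl }
  ; coset-∙ = toWitness {a? = all? λ x → all? λ y → _ ≟ᵇ _} _
  ; coset-σ = refl
  ; coset-τ = refl
  ; bit-τ = toWitness {a? = all? λ x → _ ≟ᵇ _} _
  ; τ∙τ = refl
  }

parity : Fin 2 → Bool
parity 0F = false
parity 1F = true

parity-∙ : ∀ a b → parity (AbelianGroup._∙_ (ℤ/ 2) a b) ≡ parity a xor parity b
parity-∙ = toWitness {a? = all? λ a → all? λ b → _ ≟ᵇ _} _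

-- The kernels are generated by (0, 1), (1, 0) and (1, 1); the quotient maps are the two coordinates
-- and their sum.
ℤ₂²-extension₁ ℤ₂²-extension₂ ℤ₂²-extension₃ : Extension ℤ₂²
ℤ₂²-extension₁ = record
  { σ = 1F , 0F
  ; τ = 0F , 1F
  ; coset = parity ∘ proj₁
  ; bit = parity ∘ proj₂
  ; coset-cong = λ { (refl , refl) → refl }
  ; bit-cong = λ { (refl , refl) → refl }
  ; coset-∙ = λ (a , _) (b , _) → parity-∙ a b
  ; coset-σ = refl
  ; coset-τ = refl
  ; bit-τ = λ { (_ , 0F) → refl ; (_ , 1F) → refl }
  ; τ∙τ = refl , refl
  }

ℤ₂²-extension₂ = record
  { σ = 0F , 1F
  ; τ = 1F , 0F
  ; coset = parity ∘ proj₂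
  ; bit = parity ∘ proj₁
  ; coset-cong = λ { (refl , refl) → refl }
  ; bit-cong = λ { (refl , refl) → refl }
  ; coset-∙ = λ (_ , a) (_ , b) → parity-∙ a b
  ; coset-σ = refl
  ; coset-τ = refl
  ; bit-τ = λ { (0F , _) → refl ; (1F , _) → refl }
  ; τ∙τ = refl , refl
  }

ℤ₂²-extension₃ = record
  { σ = 1F , 0F
  ; τ = 1F , 1F
  ; coset = λ (a , b) → parity a xor parity b
  ; bit = parity ∘ proj₁
  ; coset-cong = λ { (refl , refl) → refl }
  ; bit-cong = λ { (refl , refl) → refl }
  ; coset-∙ = λ (a , b) (x , y) →
      trans (cong₂ _xor_ (parity-∙ a x) (parity-∙ b y))
            (xor-interchange (parity a) (parity x) (parity b) (parity y))
  ; coset-σ = refl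
  ; coset-τ = refl
  ; bit-τ = λ { (0F , _) → refl ; (1F , _) → refl }
  ; τ∙τ = refl , refl
  }
  where
  xor-interchange : ∀ a b c d → (a xor b) xor (c xor d) ≡ (a xor c) xor (b xor d)
  xor-interchange false b c d = trans (sym (xor-assoc b c d))
    (trans (cong (_xor d) (xor-comm b c)) (xor-assoc c b d))
  xor-interchange true  b c d = trans (sym (not-distribˡ-xor b (c xor d)))
    (trans (cong not (xor-interchange false b c d)) (not-distribˡ-xor c (b xor d)))

-- Chords are arcs u → w with w < u; they precede the arcs of the path.
arcs : Vec (Arc (suc t)) β → Vec (Arc (suc t)) (β + t)
arcs chords = chords Vec.++ tabulate λ i → inject₁ i , suc i

-- A flow on the arcs is determined by its values on the chords: the arc i → i + 1
-- carries the sum over the chords u → w with w ≤ i < u.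
crossings : Vec (Arc (suc t)) β → Vec (Vec Bool β) t
crossings chords = tabulate λ i →
  Vec.map (λ (u , w) → (toℕ w ≤ᵇ toℕ i) ∧ (toℕ i <ᵇ toℕ u)) chords

graph : (es : Vec (Arc n) m) →
  {True (all? λ e → ∣ endpoints (lookup es e) ∣ ℕ.≟ 2)} →
  {True (all? λ e → all? λ f →
    endpoints (lookup es e) ≟ᵛ endpoints (lookup es f) →-dec (e ≟ f))} →
  Graph n m
graph es {size} {inj} = record
  { ends           = λ e → endpoints (lookup es e)
  ; ∣ends∣≡2       = toWitness size
  ; ends-injective = λ {e} {f} → toWitness inj e f
  }

no-loops? : (es : Vec (Arc n) m) → Dec (∀ e → proj₁ (lookup es e) ≢ proj₂ (lookup es e))
no-loops? es = all? λ e → ¬? (_ ≟ _)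

elements₄ : List (Fin 4)
elements₄ = 0F ∷ 1F ∷ 2F ∷ 3F ∷ []

complete₄ : ∀ x → Any (x ≡_) elements₄
complete₄ = toWitness {a? = all? λ x → any? (x ≟_) elements₄} _

elements₂² : List (Fin 2 × Fin 2)
elements₂² = (0F , 0F) ∷ (0F , 1F) ∷ (1F , 0F) ∷ (1F , 1F) ∷ []

_≟₂²_ : Decidable (AbelianGroup._≈_ ℤ₂²)
_≟₂²_ = ×-decidable _≟_ _≟_

complete₂² : ∀ x → Any (AbelianGroup._≈_ ℤ₂² x) elements₂²
complete₂² (a , b) = toWitness {a? = all? λ a → all? λ b → any? ((a , b) ≟₂²_) elements₂²} _ a b

-- A graph for ℤ₂² but not ℤ₄, and one for ℤ₄ but not ℤ₂²

private
  pattern O = false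
  pattern I = true

-- A cubic graph on 12 vertices with three subdivided edges: the vertices 5, 9 and 14 have degree 2.
chords₁ : Vec (Arc 15) 7
chords₁ = (# 3 , # 0) ∷ (# 8 , # 0) ∷ (# 6 , # 1) ∷ (# 12 , # 2) ∷ (# 11 , # 4) ∷
          (# 14 , # 7) ∷ (# 13 , # 10) ∷ []

graph₁ : Graph 15 21
graph₁ = graph (arcs chords₁)

-- The only two patterns without a good choice of images, found by computer.
bad bad′ : Vec Bool 14
bad  = I ∷ O ∷ O ∷ O ∷ O ∷ O ∷ O ∷ O ∷ O ∷ O ∷ O ∷ I ∷ I ∷ I ∷ []
bad′ = I ∷ O ∷ O ∷ O ∷ O ∷ O ∷ O ∷ I ∷ I ∷ I ∷ I ∷ O ∷ O ∷ I ∷ []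

graph₁-connected : Connected ℤ₂² graph₁
graph₁-connected = digraph (arcs chords₁) , (λ _ → refl) ,
  Flows.avoidable⇒connected ℤ₂² (digraph (arcs chords₁)) (units 7 Vec.++ crossings chords₁)
    (toWitness {a? = circulations? (digraph (arcs chords₁)) (units 7 Vec.++ crossings chords₁)} _)
    (Search.avoidable-by-three ℤ₂² (crossings chords₁)
      ℤ₂²-extension₁ ℤ₂²-extension₂ ℤ₂²-extension₃ (λ _ → refl)
      -- The first `refl` checks all 2^14 patterns, the others the four sums of bad patterns.
      bad bad′ refl refl refl refl refl)

-- Zeros on the chords lose nothing, by translation. Modulo 2 the path values form the pattern
-- `bad`; values reducing to a good pattern could be avoided in ℤ₄ too.
forbidden₁ : Vec (Fin 4) 21
forbidden₁ = Vec.replicate 7 0F Vec.++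
  (1F ∷ 2F ∷ 2F ∷ 2F ∷ 0F ∷ 2F ∷ 2F ∷ 2F ∷ 0F ∷ 2F ∷ 2F ∷ 3F ∷ 3F ∷ 3F ∷ [])

graph₁-not-connected : ¬ Connected ℤ₄ graph₁
graph₁-not-connected = Refutation.refute⇒¬connected ℤ₄ _≟_ elements₄ complete₄
  graph₁ (arcs chords₁) (λ _ → refl) (toWitness {a? = no-loops? (arcs chords₁)} _) forbidden₁ refl

-- This graph is the cube with three subdivided edges.
chords₂ : Vec (Arc 11) 5
chords₂ = (# 5 , # 0) ∷ (# 7 , # 1) ∷ (# 8 , # 2) ∷ (# 9 , # 4) ∷ (# 10 , # 6) ∷ []

graph₂ : Graph 11 15
graph₂ = graph (arcs chords₂)

graph₂-connected : Connected ℤ₄ graph₂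
graph₂-connected = digraph (arcs chords₂) , (λ _ → refl) ,
  Flows.avoidable⇒connected ℤ₄ (digraph (arcs chords₂)) (units 5 Vec.++ crossings chords₂)
    (toWitness {a? = circulations? (digraph (arcs chords₂)) (units 5 Vec.++ crossings chords₂)} _)
    -- The second `refl` checks the 2^10 patterns, with all 2^10 choices of second bits for each bad
    -- one.
    (Search.avoidable-by-bits ℤ₄ (crossings chords₂) ℤ₄-extension refl refl)

-- All three quotients of ℤ₂² see bad patterns here; a good one in any of them would give a flow
-- avoiding these values.
forbidden₂ : Vec (Fin 2 × Fin 2) 15
forbidden₂ = Vec.replicate 5 (0F , 0F) Vec.++
  Vec.zip (0F ∷ 0F ∷ 0F ∷ 1F ∷ 0F ∷ 0F ∷ 0F ∷ 1F ∷ 1F ∷ 1F ∷ [])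
          (1F ∷ 0F ∷ 0F ∷ 0F ∷ 0F ∷ 0F ∷ 0F ∷ 0F ∷ 1F ∷ 1F ∷ [])

graph₂-not-connected : ¬ Connected ℤ₂² graph₂
graph₂-not-connected = Refutation.refute⇒¬connected ℤ₂² _≟₂²_ elements₂² complete₂²
  graph₂ (arcs chords₂) (λ _ → refl) (toWitness {a? = no-loops? (arcs chords₂)} _) forbidden₂ refl

theorem3 : (∃₂ λ n m → Σ[ G ∈ Graph n m ] Connected ℤ₂² G × ¬ Connected ℤ₄ G)
    × (∃₂ λ n m → Σ[ G ∈ Graph n m ] Connected ℤ₄ G × ¬ Connected ℤ₂² G)
theorem3 = (15 , 21 , graph₁ , graph₁-connected , graph₁-not-connected)
         , (11 , 15 , graph₂ , graph₂-connected , graph₂-not-connected)
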